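{- Let $L = (\mathrm{STEM},\mathrm{LOOP})$ be a (conjunctive) linear lasso program. If there is a geometric nontermination argument for $L$ (of some size $k \geq 0$), then $L$ is nonterminating.
   Context: Vectors are column vectors; inequalities between vectors are componentwise. A (conjunctive) linear lasso program $L = (\mathrm{STEM}, \mathrm{LOOP})$ over $n$ real-valued variables consists of two binary relations on $\mathbb{R}^n$, each of the form $\{(\vec{x},\vec{x}') : A\begin{pmatrix}\vec{x}\\ \vec{x}'\end{pmatrix} \leq \vec{b}\}$ for some real matrix $A$ with $2n$ columns and some real vector $\vec{b}$ (the matrix and vector may differ for the two relations). $L$ is nonterminating iff it has an infinite execution, i.e. an infinite sequence of states $\vec{x}_0, \vec{x}_1, \ldots \in \mathbb{R}^n$ with $(\vec{x}_0,\vec{x}_1) \in \mathrm{STEM}$ and $(\vec{x}_t,\vec{x}_{t+1}) \in \mathrm{LOOP}$ for all $t \geq 1$. Let $A \in \mathbb{R}^{m\times 2n}$ and $\vec{b} \in \mathbb{R}^m$ define the loop transition, i.e. $(\vec{x},\vec{x}') \in \mathrm{LOOP} \iff A\begin{pmatrix}\vec{x}\\ \vec{x}'\end{pmatrix} \leq \vec{b}$. A geometric nontermination argument for $L$ of size $k \geq 0$ is a tuple $(\vec{x}_0,\vec{x}_1,\vec{y}_1,\ldots,\vec{y}_k,\lambda_1,\ldots,\lambda_k,\mu_1,\ldots,\mu_{k-1})$ such that: (domain) $\vec{x}_0,\vec{x}_1,\vec{y}_1,\ldots,\vec{y}_k \in \mathbb{R}^n$, and $\lambda_1,\ldots,\lambda_k,\mu_1,\ldots,\mu_{k-1}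 \geq 0$ are real numbers; (initiation) $(\vec{x}_0,\vec{x}_1) \in \mathrm{STEM}$; (point) $A\begin{pmatrix}\vec{x}_1\\ \vec{x}_1 + \sum_{i=1}^k \vec{y}_i\end{pmatrix} \leq \vec{b}$; (ray) if $k \geq 1$, $A\begin{pmatrix}\vec{y}_1\\ \lambda_1\vec{y}_1\end{pmatrix} \leq \vec{0}$, and $A\begin{pmatrix}\vec{y}_i\\ \lambda_i\vec{y}_i + \mu_{i-1}\vec{y}_{i-1}\end{pmatrix} \leq \vec{0}$ for $1 < i \leq k$. -}

module Defs where

open import Algebra.Bundles using (CommutativeRing)
import Algebra.Properties.Monoid.Sum as MonoidSum
open import Data.Fin.Base as Fin using (Fin; inject₁)
open import Data.Nat.Base as ℕ using (ℕ; zero; suc; _⊔_; _∸_)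
import Data.Nat.Properties as ℕ
open import Data.Product.Base using (Σ-syntax; ∃-syntax; _×_; _,_)
open import Data.Rational.Base as ℚ using (ℚ; 0ℚ; 1ℚ; ½; ∣_∣)
import Data.Rational.Properties as ℚ
open import Data.Rational.Solver using (module +-*-Solver)
open import Data.Unit.Base using (⊤)
open import Data.Vec.Functional using (Vector; _++_; zipWith; map)
open import Level using (0ℓ)
open import Relation.Binary.Core using (Rel)
open import Relation.Binary.PropositionalEquality
  using (_≡_; refl; sym; trans; cong; cong₂; subst; subst₂)

open +-*-Solver using (solve; _:=_; _:+_; _:*_; _:-_; :-_)

module RationalEstimates where

  half-pos : ∀ {ε} → 0ℚ ℚ.< ε → 0ℚ ℚ.< ε ℚ.* ½
  half-pos {ε} ε>0 = subst (ℚ._< ε ℚ.* ½) (ℚ.*-zeroˡ ½) (ℚ.*-monoˡ-<-pos ½ ε>0)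

  half+half : ∀ ε → ε ℚ.* ½ ℚ.+ ε ℚ.* ½ ≡ ε
  half+half ε = trans (sym (ℚ.*-distribˡ-+ ε ½ ½)) (ℚ.*-identityʳ ε)

  ∣p-q∣≡∣q-p∣ : ∀ p q → ∣ p ℚ.- q ∣ ≡ ∣ q ℚ.- p ∣
  ∣p-q∣≡∣q-p∣ p q = trans
    (cong ∣_∣ (solve 2 (λ p q → p :- q := :- (q :- p)) refl p q))
    (ℚ.∣-p∣≡∣p∣ (q ℚ.- p))

  ∣-p--q∣≡∣p-q∣ : ∀ p q → ∣ (ℚ.- p) ℚ.- (ℚ.- q) ∣ ≡ ∣ p ℚ.- q ∣
  ∣-p--q∣≡∣p-q∣ p q = trans
    (cong ∣_∣ (solve 2 (λ p q → (:- p) :- (:- q) := q :- p) refl p q))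
    (∣p-q∣≡∣q-p∣ q p)

  ∣p-p∣<ε : ∀ p {ε} → 0ℚ ℚ.< ε → ∣ p ℚ.- p ∣ ℚ.< ε
  ∣p-p∣<ε p {ε} = subst (ℚ._< ε) (sym (cong ∣_∣ (ℚ.+-inverseʳ p)))

  ∣sum∣<ε : ∀ {ε} p q → ∣ p ∣ ℚ.< ε ℚ.* ½ → ∣ q ∣ ℚ.< ε ℚ.* ½ → ∣ p ℚ.+ q ∣ ℚ.< ε
  ∣sum∣<ε {ε} p q p<ε/2 q<ε/2 = ℚ.≤-<-trans (ℚ.∣p+q∣≤∣p∣+∣q∣ p q)
    (subst (∣ p ∣ ℚ.+ ∣ q ∣ ℚ.<_) (half+half ε) (ℚ.+-mono-< p<ε/2 q<ε/2))

  triangle : ∀ {ε} p q r → ∣ p ℚ.- q ∣ ℚ.< ε ℚ.* ½ → ∣ q ℚ.- r ∣ ℚ.< ε ℚ.* ½ →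
             ∣ p ℚ.- r ∣ ℚ.< ε
  triangle {ε} p q r h h′ = subst (λ s → ∣ s ∣ ℚ.< ε)
    (solve 3 (λ p q r → (p :- q) :+ (q :- r) := p :- r) refl p q r)
    (∣sum∣<ε (p ℚ.- q) (q ℚ.- r) h h′)

  sum-close : ∀ {ε} a b c d → ∣ a ℚ.- c ∣ ℚ.< ε ℚ.* ½ → ∣ b ℚ.- d ∣ ℚ.< ε ℚ.* ½ →
              ∣ (a ℚ.+ b) ℚ.- (c ℚ.+ d) ∣ ℚ.< ε
  sum-close {ε} a b c d h h′ = subst (λ s → ∣ s ∣ ℚ.< ε)
    (solve 4 (λ a b c d → (a :- c) :+ (b :- d) := (a :+ b) :- (c :+ d)) refl a b c d)
    (∣sum∣<ε (a ℚ.- c) (b ℚ.- d) h h′)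

  ∣p*q∣<B*δ : ∀ {B δ} p q → 0ℚ ℚ.< B → ∣ p ∣ ℚ.≤ B → ∣ q ∣ ℚ.< δ → ∣ p ℚ.* q ∣ ℚ.< B ℚ.* δ
  ∣p*q∣<B*δ {B} {δ} p q B>0 p≤B q<δ = ℚ.≤-<-trans
    (subst (ℚ._≤ B ℚ.* ∣ q ∣) (sym (ℚ.∣p*q∣≡∣p∣*∣q∣ p q))
      (ℚ.*-monoʳ-≤-nonNeg ∣ q ∣ {{ℚ.∣-∣-nonNeg q}} p≤B))
    (ℚ.*-monoʳ-<-pos B {{ℚ.positive B>0}} q<δ)

  product-close : ∀ {B C δ} a b c d → 0ℚ ℚ.< B → 0ℚ ℚ.< C →
                  ∣ a ∣ ℚ.≤ B → ∣ d ∣ ℚ.≤ C →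
                  ∣ a ℚ.- c ∣ ℚ.< δ → ∣ b ℚ.- d ∣ ℚ.< δ →
                  ∣ (a ℚ.* b) ℚ.- (c ℚ.* d) ∣ ℚ.< (B ℚ.+ C) ℚ.* δ
  product-close {B} {C} {δ} a b c d B>0 C>0 a≤B d≤C ac bd = subst₂ ℚ._<_
    (cong ∣_∣ (solve 4 (λ a b c d → a :* (b :- d) :+ d :* (a :- c) := a :* b :- c :* d)
                 refl a b c d))
    (sym (ℚ.*-distribʳ-+ δ B C))
    (ℚ.≤-<-trans (ℚ.∣p+q∣≤∣p∣+∣q∣ (a ℚ.* (b ℚ.- d)) (d ℚ.* (a ℚ.- c)))
      (ℚ.+-mono-< (∣p*q∣<B*δ a (b ℚ.- d) B>0 a≤B bd) (∣p*q∣<B*δ d (a ℚ.- c) C>0 d≤C ac)))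

  quotient : ∀ {B ε} → 0ℚ ℚ.< B → 0ℚ ℚ.< ε → Σ[ δ ∈ ℚ ] (0ℚ ℚ.< δ × B ℚ.* δ ≡ ε)
  quotient {B} {ε} B>0 ε>0 = 1/B ℚ.* ε , δ>0 , B*δ≡ε
    where
    instance
      B-pos = ℚ.positive B>0
      ε-pos = ℚ.positive ε>0
      B-nonZero = ℚ.pos⇒nonZero B
    1/B = ℚ.1/ B
    instance
      1/B-pos = ℚ.1/pos⇒pos B
    δ>0 : 0ℚ ℚ.< 1/B ℚ.* ε
    δ>0 = ℚ.positive⁻¹ (1/B ℚ.* ε) {{ℚ.pos*pos⇒pos 1/B ε}}
    B*δ≡ε : B ℚ.* (1/B ℚ.* ε) ≡ ε
    B*δ≡ε = trans (sym (ℚ.*-assoc B 1/B ε))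
      (trans (cong (ℚ._* ε) (ℚ.*-inverseʳ B)) (ℚ.*-identityˡ ε))

  ⊔-splitˡ : ∀ {M N n} → M ⊔ N ℕ.≤ n → M ℕ.≤ n
  ⊔-splitˡ {M} {N} = ℕ.m⊔n≤o⇒m≤o M N

  ⊔-splitʳ : ∀ {M N n} → M ⊔ N ℕ.≤ n → N ℕ.≤ n
  ⊔-splitʳ {M} {N} = ℕ.m⊔n≤o⇒n≤o M N

open RationalEstimates

-- Cauchy sequences of rationals represent the reals; equality of reals is _≈_.

infixl 7 _*_
infixl 6 _+_
infix  8 -_
infix  4 _≈_ _≤_

IsCauchy : (ℕ → ℚ) → Set
IsCauchy s = ∀ ε → 0ℚ ℚ.< ε →
             ∃[ N ] ∀ m n → N ℕ.≤ m → N ℕ.≤ n → ∣ s m ℚ.- s n ∣ ℚ.< ε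

record ℝ : Set where
  constructor mkℝ
  field
    seq    : ℕ → ℚ
    cauchy : IsCauchy seq

open ℝ public

record _≈_ (x y : ℝ) : Set where
  constructor mk≈
  field
    close : ∀ ε → 0ℚ ℚ.< ε → ∃[ N ] ∀ n → N ℕ.≤ n → ∣ seq x n ℚ.- seq y n ∣ ℚ.< ε

open _≈_ public

record _≤_ (x y : ℝ) : Set where
  constructor mk≤
  field
    below : ∀ ε → 0ℚ ℚ.< ε → ∃[ N ] ∀ n → N ℕ.≤ n → seq x n ℚ.< seq y n ℚ.+ ε

open _≤_ public

fromℚ : ℚ → ℝ
fromℚ p = mkℝ (λ _ → p) (λ _ ε>0 → 0 , λ _ _ _ _ → ∣p-p∣<ε p ε>0)

0ℝ 1ℝ : ℝ
0ℝ = fromℚ 0ℚ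
1ℝ = fromℚ 1ℚ

bound : ∀ x → ∃[ B ] (0ℚ ℚ.< B × ∃[ N ] (∀ n → N ℕ.≤ n → ∣ seq x n ∣ ℚ.≤ B))
bound x with cauchy x 1ℚ (ℚ.positive⁻¹ 1ℚ)
... | N , h = ∣ seq x N ∣ ℚ.+ 1ℚ
  , ℚ.+-mono-≤-< (ℚ.0≤∣p∣ (seq x N)) (ℚ.positive⁻¹ 1ℚ)
  , N , λ n N≤n → subst (ℚ._≤ ∣ seq x N ∣ ℚ.+ 1ℚ)
      (cong ∣_∣ (solve 2 (λ p q → p :+ (q :- p) := q) refl (seq x N) (seq x n)))
      (ℚ.≤-trans (ℚ.∣p+q∣≤∣p∣+∣q∣ (seq x N) (seq x n ℚ.- seq x N))
        (ℚ.+-monoʳ-≤ ∣ seq x N ∣ (ℚ.<⇒≤ (h n N N≤n ℕ.≤-refl))))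

-- Abstract so that normal forms of real expressions do not carry these proofs.
private
  abstract
    +-cauchy : ∀ x y → IsCauchy (λ n → seq x n ℚ.+ seq y n)
    +-cauchy x y ε ε>0 =
      let M , hx = cauchy x (ε ℚ.* ½) (half-pos ε>0)
          N , hy = cauchy y (ε ℚ.* ½) (half-pos ε>0)
      in M ⊔ N , λ m n m≥ n≥ → sum-close (seq x m) (seq y m) (seq x n) (seq y n)
           (hx m n (⊔-splitˡ m≥) (⊔-splitˡ n≥))
           (hy m n (⊔-splitʳ {M} m≥) (⊔-splitʳ {M} n≥))

    -‿cauchy : ∀ x → IsCauchy (λ n → ℚ.- seq x n)
    -‿cauchy x ε ε>0 =
      let N , h = cauchy x ε ε>0
      in N , λ m n m≥ n≥ →
           subst (ℚ._< ε) (sym (∣-p--q∣≡∣p-q∣ (seq x m) (seq x n))) (h m n m≥ n≥)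

    *-cauchy : ∀ x y → IsCauchy (λ n → seq x n ℚ.* seq y n)
    *-cauchy x y ε ε>0 =
      let B , B>0 , K , x≤B = bound x
          C , C>0 , L , y≤C = bound y
          δ , δ>0 , B+C*δ≡ε = quotient (ℚ.+-mono-< B>0 C>0) ε>0
          M , hx = cauchy x δ δ>0
          N , hy = cauchy y δ δ>0
      in (K ⊔ L) ⊔ (M ⊔ N) , λ m n m≥ n≥ → subst (_ ℚ.<_) B+C*δ≡ε
           (product-close (seq x m) (seq y m) (seq x n) (seq y n) B>0 C>0
             (x≤B m (⊔-splitˡ (⊔-splitˡ m≥)))
             (y≤C n (⊔-splitʳ {K} (⊔-splitˡ n≥)))
             (hx m n (⊔-splitˡ (⊔-splitʳ {K ⊔ L} m≥)) (⊔-splitˡ (⊔-splitʳ {K ⊔ L} n≥)))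
             (hy m n (⊔-splitʳ {M} (⊔-splitʳ {K ⊔ L} m≥))
                     (⊔-splitʳ {M} (⊔-splitʳ {K ⊔ L} n≥))))

_+_ : ℝ → ℝ → ℝ
x + y = mkℝ (λ n → seq x n ℚ.+ seq y n) (+-cauchy x y)

-_ : ℝ → ℝ
- x = mkℝ (λ n → ℚ.- seq x n) (-‿cauchy x)

_*_ : ℝ → ℝ → ℝ
x * y = mkℝ (λ n → seq x n ℚ.* seq y n) (*-cauchy x y)

private
  abstract
    pointwise : ∀ x y → (∀ n → seq x n ≡ seq y n) → x ≈ y
    pointwise x y eq = mk≈ λ ε ε>0 → 0 , λ n _ →
      subst (λ q → ∣ seq x n ℚ.- q ∣ ℚ.< ε) (eq n) (∣p-p∣<ε (seq x n) ε>0)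

    ≈-refl : ∀ {x} → x ≈ x
    ≈-refl {x} = pointwise x x λ _ → refl

    ≈-sym : ∀ {x y} → x ≈ y → y ≈ x
    ≈-sym {x} {y} x≈y = mk≈ λ ε ε>0 →
      let N , h = close x≈y ε ε>0
      in N , λ n n≥ → subst (ℚ._< ε) (∣p-q∣≡∣q-p∣ (seq x n) (seq y n)) (h n n≥)

    ≈-trans : ∀ {x y z} → x ≈ y → y ≈ z → x ≈ z
    ≈-trans {x} {y} {z} x≈y y≈z = mk≈ λ ε ε>0 →
      let M , h  = close x≈y (ε ℚ.* ½) (half-pos ε>0)
          N , h′ = close y≈z (ε ℚ.* ½) (half-pos ε>0)
      in M ⊔ N , λ n n≥ → triangle (seq x n) (seq y n) (seq z n)
           (h n (⊔-splitˡ n≥)) (h′ n (⊔-splitʳ {M} n≥))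

    +-cong : ∀ {x y u v} → x ≈ y → u ≈ v → x + u ≈ y + v
    +-cong {x} {y} {u} {v} x≈y u≈v = mk≈ λ ε ε>0 →
      let M , h  = close x≈y (ε ℚ.* ½) (half-pos ε>0)
          N , h′ = close u≈v (ε ℚ.* ½) (half-pos ε>0)
      in M ⊔ N , λ n n≥ → sum-close (seq x n) (seq u n) (seq y n) (seq v n)
           (h n (⊔-splitˡ n≥)) (h′ n (⊔-splitʳ {M} n≥))

    -‿cong : ∀ {x y} → x ≈ y → - x ≈ - y
    -‿cong {x} {y} x≈y = mk≈ λ ε ε>0 →
      let N , h = close x≈y ε ε>0
      in N , λ n n≥ → subst (ℚ._< ε) (sym (∣-p--q∣≡∣p-q∣ (seq x n) (seq y n))) (h n n≥)

    *-cong : ∀ {x y u v} → x ≈ y → u ≈ v → x * u ≈ y * v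
    *-cong {x} {y} {u} {v} x≈y u≈v = mk≈ λ ε ε>0 →
      let B , B>0 , K , x≤B = bound x
          C , C>0 , L , v≤C = bound v
          δ , δ>0 , B+C*δ≡ε = quotient (ℚ.+-mono-< B>0 C>0) ε>0
          M , h  = close x≈y δ δ>0
          N , h′ = close u≈v δ δ>0
      in (K ⊔ L) ⊔ (M ⊔ N) , λ n n≥ → subst (_ ℚ.<_) B+C*δ≡ε
           (product-close (seq x n) (seq u n) (seq y n) (seq v n) B>0 C>0
             (x≤B n (⊔-splitˡ (⊔-splitˡ n≥)))
             (v≤C n (⊔-splitʳ {K} (⊔-splitˡ n≥)))
             (h n (⊔-splitˡ (⊔-splitʳ {K ⊔ L} n≥)))
             (h′ n (⊔-splitʳ {M} (⊔-splitʳ {K ⊔ L} n≥))))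

    +-assoc : ∀ x y z → (x + y) + z ≈ x + (y + z)
    +-assoc x y z = pointwise ((x + y) + z) (x + (y + z))
      λ n → ℚ.+-assoc (seq x n) (seq y n) (seq z n)

    +-comm : ∀ x y → x + y ≈ y + x
    +-comm x y = pointwise (x + y) (y + x) λ n → ℚ.+-comm (seq x n) (seq y n)

    +-identityˡ : ∀ x → 0ℝ + x ≈ x
    +-identityˡ x = pointwise (0ℝ + x) x λ n → ℚ.+-identityˡ (seq x n)

    +-identityʳ : ∀ x → x + 0ℝ ≈ x
    +-identityʳ x = pointwise (x + 0ℝ) x λ n → ℚ.+-identityʳ (seq x n)

    +-inverseˡ : ∀ x → - x + x ≈ 0ℝ
    +-inverseˡ x = pointwise (- x + x) 0ℝ λ n → ℚ.+-inverseˡ (seq x n)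

    +-inverseʳ : ∀ x → x + - x ≈ 0ℝ
    +-inverseʳ x = pointwise (x + - x) 0ℝ λ n → ℚ.+-inverseʳ (seq x n)

    *-assoc : ∀ x y z → (x * y) * z ≈ x * (y * z)
    *-assoc x y z = pointwise ((x * y) * z) (x * (y * z))
      λ n → ℚ.*-assoc (seq x n) (seq y n) (seq z n)

    *-comm : ∀ x y → x * y ≈ y * x
    *-comm x y = pointwise (x * y) (y * x) λ n → ℚ.*-comm (seq x n) (seq y n)

    *-identityˡ : ∀ x → 1ℝ * x ≈ x
    *-identityˡ x = pointwise (1ℝ * x) x λ n → ℚ.*-identityˡ (seq x n)

    *-identityʳ : ∀ x → x * 1ℝ ≈ x
    *-identityʳ x = pointwise (x * 1ℝ) x λ n → ℚ.*-identityʳ (seq x n)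

    *-distribˡ-+ : ∀ x y z → x * (y + z) ≈ x * y + x * z
    *-distribˡ-+ x y z = pointwise (x * (y + z)) (x * y + x * z)
      λ n → ℚ.*-distribˡ-+ (seq x n) (seq y n) (seq z n)

    *-distribʳ-+ : ∀ x y z → (y + z) * x ≈ y * x + z * x
    *-distribʳ-+ x y z = pointwise ((y + z) * x) (y * x + z * x)
      λ n → ℚ.*-distribʳ-+ (seq x n) (seq y n) (seq z n)

ℝ-commutativeRing : CommutativeRing 0ℓ 0ℓ
ℝ-commutativeRing = record
  { Carrier = ℝ ; _≈_ = _≈_ ; _+_ = _+_ ; _*_ = _*_ ; -_ = -_ ; 0# = 0ℝ ; 1# = 1ℝ
  ; isCommutativeRing = record
    { isRing = record
      { +-isAbelianGroup = record
        { isGroup = record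
          { isMonoid = record
            { isSemigroup = record
              { isMagma = record
                { isEquivalence = record { refl = ≈-refl ; sym = ≈-sym ; trans = ≈-trans }
                ; ∙-cong = +-cong
                }
              ; assoc = +-assoc
              }
            ; identity = +-identityˡ , +-identityʳ
            }
          ; inverse = +-inverseˡ , +-inverseʳ
          ; ⁻¹-cong = -‿cong
          }
        ; comm = +-comm
        }
      ; *-cong = *-cong
      ; *-assoc = *-assoc
      ; *-identity = *-identityˡ , *-identityʳ
      ; distrib = *-distribˡ-+ , *-distribʳ-+
      }
    ; *-comm = *-comm
    }
  }

open MonoidSum (CommutativeRing.+-monoid ℝ-commutativeRing) public using (sum)

infixl 7 _*ₛ_ _*ᵥ_
infixl 6 _+ᵥ_
infix  4 _≤ᵥ_

Matrix : ℕ → ℕ → Set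
Matrix m n = Fin m → Fin n → ℝ

_+ᵥ_ : ∀ {n} → Vector ℝ n → Vector ℝ n → Vector ℝ n
_+ᵥ_ = zipWith _+_

_*ₛ_ : ∀ {n} → ℝ → Vector ℝ n → Vector ℝ n
c *ₛ v = map (c *_) v

_*ᵥ_ : ∀ {m n} → Matrix m n → Vector ℝ n → Vector ℝ m
(A *ᵥ v) i = sum (zipWith _*_ (A i) v)

_≤ᵥ_ : ∀ {n} → Vector ℝ n → Vector ℝ n → Set
u ≤ᵥ v = ∀ i → u i ≤ v i

0ᵥ : ∀ {n} → Vector ℝ n
0ᵥ _ = 0ℝ

sumᵥ : ∀ {k n} → Vector (Vector ℝ n) k → Vector ℝ n
sumᵥ ys j = sum (λ i → ys i j)

record LinearRelation (n : ℕ) : Set where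
  field
    rows : ℕ
    A    : Matrix rows (n ℕ.+ n)
    b    : Vector ℝ rows

⟦_⟧ : ∀ {n} → LinearRelation n → Rel (Vector ℝ n) 0ℓ
⟦ R ⟧ x x′ = A *ᵥ (x ++ x′) ≤ᵥ b
  where open LinearRelation R

record LassoProgram (n : ℕ) : Set where
  field
    STEM LOOP : LinearRelation n

Nonterminating : ∀ {n} → LassoProgram n → Set
Nonterminating {n} L = Σ[ x ∈ (ℕ → Vector ℝ n) ]
  (⟦ STEM ⟧ (x 0) (x 1) × (∀ t → 1 ℕ.≤ t → ⟦ LOOP ⟧ (x t) (x (suc t))))
  where open LassoProgram L

-- Indices are shifted to start at 0: the entry μ i is the coefficient of y i
-- in the condition for y (suc i).
Ray : ∀ {m n} → Matrix m (n ℕ.+ n) → ∀ k →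
      Vector (Vector ℝ n) k → Vector ℝ k → Vector ℝ (k ∸ 1) → Set
Ray A zero    y lam μ = ⊤
Ray A (suc k) y lam μ =
  (A *ᵥ (y Fin.zero ++ lam Fin.zero *ₛ y Fin.zero) ≤ᵥ 0ᵥ) ×
  (∀ (i : Fin k) →
     A *ᵥ (y (Fin.suc i) ++ (lam (Fin.suc i) *ₛ y (Fin.suc i) +ᵥ μ i *ₛ y (inject₁ i))) ≤ᵥ 0ᵥ)

record GeometricNonterminationArgument {n : ℕ} (L : LassoProgram n) (k : ℕ) : Set where
  open LassoProgram L
  open LinearRelation LOOP
  field
    x₀ x₁      : Vector ℝ n
    y          : Vector (Vector ℝ n) k
    lam        : Vector ℝ k
    μ          : Vector ℝ (k ∸ 1)
    lam-nonneg : ∀ i → 0ℝ ≤ lam i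
    μ-nonneg   : ∀ i → 0ℝ ≤ μ i
    initiation : ⟦ STEM ⟧ x₀ x₁
    point      : A *ᵥ (x₁ ++ (x₁ +ᵥ sumᵥ y)) ≤ᵥ b
    ray        : Ray A k y lam μ

{-# OPTIONS --safe #-}
-- The execution is x_{t+1} = x_t + Σᵢ wᵢ yᵢ, where the weights w start at 1 and
-- evolve by w′ᵢ = λᵢ wᵢ + μᵢ wᵢ₊₁ (0-based).  With zᵢ = λᵢ yᵢ + μᵢ₋₁ yᵢ₋₁ this gives
-- Σ w′ᵢ yᵢ = Σ wᵢ zᵢ, so from one step to the next the pair (x_t , x_{t+1}) moves by
-- Σ wᵢ (yᵢ , zᵢ), a nonnegative combination of rays of LOOP.
module Submission where

open import Defs
open import Algebra.Bundles using (CommutativeRing)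
import Algebra.Properties.CommutativeMonoid.Sum as CommutativeMonoidSum
import Algebra.Properties.Semiring.Sum as SemiringSum
import Algebra.Solver.Ring.NaturalCoefficients.Default as RingSolver
open import Data.Fin.Base using (zero; suc; inject₁; splitAt)
open import Data.Nat.Base as ℕ using (ℕ; zero; suc; _⊔_; _∸_)
open import Data.Product.Base using (∃-syntax; _,_)
open import Data.Rational.Base as ℚ using (0ℚ; ½; ∣_∣)
import Data.Rational.Properties as ℚ
open import Data.Rational.Solver using (module +-*-Solver)
open import Data.Sum.Base using (inj₁; inj₂)
open import Data.Vec.Functional using (Vector; _++_; tail; zipWith)
open import Relation.Binary.PropositionalEquality as ≡
  using (_≡_; cong; subst; subst₂)
import Relation.Binary.Reasoning.Setoid as ≈-Reasoning

open RationalEstimates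
open CommutativeRing ℝ-commutativeRing
  using (setoid; semiring; commutativeSemiring; +-commutativeMonoid; refl; sym; trans;
         *-congˡ; +-congˡ; +-congʳ; +-identityʳ; *-identityˡ; zeroʳ; distribˡ)
open CommutativeMonoidSum +-commutativeMonoid using (sum-cong-≋; ∑-distrib-+; ∑-comm)
open SemiringSum semiring using (*-distribˡ-sum)
open RingSolver commutativeSemiring using (solve; _:=_; _:+_; _:*_)
open +-*-Solver using ()
  renaming (solve to solveℚ; _:=_ to _⊜_; _:+_ to _⊕_; _:*_ to _⊗_; _:-_ to _⊖_; :-_ to ⊝_)

-- Order properties of the Cauchy reals.

p≤∣p∣ : ∀ p → p ℚ.≤ ∣ p ∣
p≤∣p∣ p with ℚ.≤-total 0ℚ p
... | inj₁ 0≤p = ℚ.≤-reflexive (≡.sym (ℚ.0≤p⇒∣p∣≡p 0≤p))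
... | inj₂ p≤0 = ℚ.≤-trans p≤0 (ℚ.0≤∣p∣ p)

-- Terms of sequences representing a nonnegative and a nonpositive real may violate their sign by
-- less than `δ`, so their product can be slightly positive. If `q` is nonnegative, its size is
-- below `δ` and the product is below `B * δ`; if `p` is nonpositive, the product is likewise below
-- `C * δ`; in the remaining case it is at most 0.
almost-nonneg*almost-nonpos : ∀ {B C δ} p q → 0ℚ ℚ.< B → 0ℚ ℚ.< C → 0ℚ ℚ.< δ →
  ∣ p ∣ ℚ.≤ B → ∣ q ∣ ℚ.≤ C → ℚ.- p ℚ.< δ → q ℚ.< δ → p ℚ.* q ℚ.< (B ℚ.+ C) ℚ.* δ
almost-nonneg*almost-nonpos {B} {C} {δ} p q B>0 C>0 δ>0 p≤B q≤C -p<δ q<δ =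
  subst (p ℚ.* q ℚ.<_) (≡.sym (ℚ.*-distribʳ-+ δ B C)) bounded
  where
  scaled-pos : ∀ {D} → 0ℚ ℚ.< D → 0ℚ ℚ.< D ℚ.* δ
  scaled-pos {D} D>0 = subst (ℚ._< D ℚ.* δ) (ℚ.*-zeroˡ δ)
    (ℚ.*-monoˡ-<-pos δ {{ℚ.positive δ>0}} D>0)

  bounded : p ℚ.* q ℚ.< B ℚ.* δ ℚ.+ C ℚ.* δ
  bounded with ℚ.∣p∣≡p∨∣p∣≡-p q | ℚ.∣p∣≡p∨∣p∣≡-p p
  ... | inj₁ ∣q∣≡q | _ = subst (ℚ._< _) (ℚ.+-identityʳ (p ℚ.* q)) (ℚ.+-mono-<
    (ℚ.≤-<-trans (p≤∣p∣ (p ℚ.* q))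
      (∣p*q∣<B*δ p q B>0 p≤B (subst (ℚ._< δ) (≡.sym ∣q∣≡q) q<δ)))
    (scaled-pos C>0))
  ... | inj₂ _ | inj₂ ∣p∣≡-p = subst (ℚ._< _) (≡.trans (ℚ.+-identityˡ (q ℚ.* p)) (ℚ.*-comm q p))
    (ℚ.+-mono-< (scaled-pos B>0) (ℚ.≤-<-trans (p≤∣p∣ (q ℚ.* p))
      (∣p*q∣<B*δ q p C>0 q≤C (subst (ℚ._< δ) (≡.sym ∣p∣≡-p) -p<δ))))
  ... | inj₂ ∣q∣≡-q | inj₁ ∣p∣≡p = ℚ.≤-<-trans p*q≤0
    (ℚ.+-mono-< (scaled-pos B>0) (scaled-pos C>0))
    where
    p*q≤0 : p ℚ.* q ℚ.≤ 0ℚ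
    p*q≤0 = subst (ℚ._≤ 0ℚ)
      (≡.trans (cong ℚ.-_ (≡.trans (ℚ.∣p*q∣≡∣p∣*∣q∣ p q) (≡.cong₂ ℚ._*_ ∣p∣≡p ∣q∣≡-q)))
        (solveℚ 2 (λ p q → ⊝ (p ⊗ (⊝ q)) ⊜ p ⊗ q) ≡.refl p q))
      (ℚ.neg-antimono-≤ (ℚ.0≤∣p∣ (p ℚ.* q)))

+-halves : ∀ q ε → q ℚ.+ ε ℚ.* ½ ℚ.+ ε ℚ.* ½ ≡ q ℚ.+ ε
+-halves q ε = ≡.trans (ℚ.+-assoc q (ε ℚ.* ½) (ε ℚ.* ½)) (cong (q ℚ.+_) (half+half ε))

≤-trans : ∀ {x y z} → x ≤ y → y ≤ z → x ≤ z
≤-trans {x} {y} {z} x≤y y≤z = mk≤ λ ε ε>0 →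
  let M , h  = below x≤y (ε ℚ.* ½) (half-pos ε>0)
      N , h′ = below y≤z (ε ℚ.* ½) (half-pos ε>0)
  in M ⊔ N , λ n n≥ → subst (seq x n ℚ.<_) (+-halves (seq z n) ε)
       (ℚ.<-trans (h n (⊔-splitˡ n≥))
         (ℚ.+-monoˡ-< (ε ℚ.* ½) (h′ n (⊔-splitʳ {M} n≥))))

≤-reflexive : ∀ {x y} → x ≈ y → x ≤ y
≤-reflexive {x} {y} x≈y = mk≤ λ ε ε>0 →
  let N , h = close x≈y ε ε>0
  in N , λ n n≥ → subst (ℚ._< seq y n ℚ.+ ε)
       (solveℚ 2 (λ p q → q ⊕ (p ⊖ q) ⊜ p) ≡.refl (seq x n) (seq y n))
       (ℚ.+-monoʳ-< (seq y n) (ℚ.≤-<-trans (p≤∣p∣ (seq x n ℚ.- seq y n)) (h n n≥)))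

+-mono-≤ : ∀ {x y u v} → x ≤ y → u ≤ v → x + u ≤ y + v
+-mono-≤ {x} {y} {u} {v} x≤y u≤v = mk≤ λ ε ε>0 →
  let M , h  = below x≤y (ε ℚ.* ½) (half-pos ε>0)
      N , h′ = below u≤v (ε ℚ.* ½) (half-pos ε>0)
  in M ⊔ N , λ n n≥ → subst (seq x n ℚ.+ seq u n ℚ.<_)
       (≡.trans
         (solveℚ 3 (λ p q e → (p ⊕ e) ⊕ (q ⊕ e) ⊜ p ⊕ q ⊕ e ⊕ e) ≡.refl
           (seq y n) (seq v n) (ε ℚ.* ½))
         (+-halves (seq y n ℚ.+ seq v n) ε))
       (ℚ.+-mono-< (h n (⊔-splitˡ n≥)) (h′ n (⊔-splitʳ {M} n≥)))

-- Writing `c * x` as `c * y + c * (x - y)` leaves a product of an almost nonnegative and an almost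
-- nonpositive factor. Both factors are eventually bounded, by `B` and `C`, and `δ` is chosen so
-- that the resulting error `(B + C) * δ` is exactly `ε`.
*-monoˡ-≤-nonNeg : ∀ {c x y} → 0ℝ ≤ c → x ≤ y → c * x ≤ c * y
*-monoˡ-≤-nonNeg {c} {x} {y} 0≤c x≤y = mk≤ λ ε ε>0 →
  let B , B>0 , K , c≤B = bound c
      -- The terms of `x + - y` are by definition the differences `seq x n - seq y n` estimated
      -- below.
      C , C>0 , L , d≤C = bound (x + - y)
      δ , δ>0 , B+C*δ≡ε = quotient (ℚ.+-mono-< B>0 C>0) ε>0
      M , h  = below 0≤c δ δ>0
      N , h′ = below x≤y δ δ>0
  in (K ⊔ L) ⊔ (M ⊔ N) , λ n n≥ → subst₂ ℚ._<_
       (solveℚ 3 (λ c x y → c ⊗ y ⊕ c ⊗ (x ⊖ y) ⊜ c ⊗ x) ≡.refl (seq c n) (seq x n) (seq y n))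
       (cong (seq c n ℚ.* seq y n ℚ.+_) B+C*δ≡ε)
       (ℚ.+-monoʳ-< (seq c n ℚ.* seq y n)
         (almost-nonneg*almost-nonpos (seq c n) (seq x n ℚ.- seq y n) B>0 C>0 δ>0
           (c≤B n (⊔-splitˡ (⊔-splitˡ n≥)))
           (d≤C n (⊔-splitʳ {K} (⊔-splitˡ n≥)))
           (subst₂ ℚ._<_ (ℚ.+-identityˡ (ℚ.- seq c n))
             (solveℚ 2 (λ c e → (c ⊕ e) ⊖ c ⊜ e) ≡.refl (seq c n) δ)
             (ℚ.+-monoˡ-< (ℚ.- seq c n) (h n (⊔-splitˡ (⊔-splitʳ {K ⊔ L} n≥)))))
           (subst (seq x n ℚ.- seq y n ℚ.<_)
             (solveℚ 2 (λ y e → (y ⊕ e) ⊖ y ⊜ e) ≡.refl (seq y n) δ)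
             (ℚ.+-monoˡ-< (ℚ.- seq y n) (h′ n (⊔-splitʳ {M} (⊔-splitʳ {K ⊔ L} n≥)))))))

≤-respˡ-≈ : ∀ {x x′ y} → x ≈ x′ → x ≤ y → x′ ≤ y
≤-respˡ-≈ x≈x′ = ≤-trans (≤-reflexive (sym x≈x′))

≤-respʳ-≈ : ∀ {x y y′} → y ≈ y′ → x ≤ y → x ≤ y′
≤-respʳ-≈ y≈y′ x≤y = ≤-trans x≤y (≤-reflexive y≈y′)

+-nonneg : ∀ {x y} → 0ℝ ≤ x → 0ℝ ≤ y → 0ℝ ≤ x + y
+-nonneg 0≤x 0≤y = ≤-respˡ-≈ (+-identityʳ 0ℝ) (+-mono-≤ 0≤x 0≤y)

*-nonneg : ∀ {x y} → 0ℝ ≤ x → 0ℝ ≤ y → 0ℝ ≤ x * y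
*-nonneg {x} 0≤x 0≤y = ≤-respˡ-≈ (zeroʳ x) (*-monoˡ-≤-nonNeg 0≤x 0≤y)

0≤1 : 0ℝ ≤ 1ℝ
0≤1 = mk≤ λ ε ε>0 → 0 , λ _ _ → ℚ.+-mono-< (ℚ.positive⁻¹ ℚ.1ℚ) ε>0

sum-nonpos : ∀ {k} (t : Vector ℝ k) → t ≤ᵥ 0ᵥ → sum t ≤ 0ℝ
sum-nonpos {zero}  t t≤0 = ≤-reflexive refl
sum-nonpos {suc k} t t≤0 =
  ≤-respʳ-≈ (+-identityʳ 0ℝ) (+-mono-≤ (t≤0 zero) (sum-nonpos (tail t) λ i → t≤0 (suc i)))

-- Linear algebra: concatenation, linear combinations and matrix action.

infix 4 _≋_

_≋_ : ∀ {n} → Vector ℝ n → Vector ℝ n → Set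
u ≋ v = ∀ i → u i ≈ v i

lincomb : ∀ {k n} → Vector ℝ k → Vector (Vector ℝ n) k → Vector ℝ n
lincomb w vs = sumᵥ λ i → w i *ₛ vs i

++-cong : ∀ {m n} {u u′ : Vector ℝ m} {v v′ : Vector ℝ n} →
          u ≋ u′ → v ≋ v′ → u ++ v ≋ u′ ++ v′
++-cong {m} u≋u′ v≋v′ i with splitAt m i
... | inj₁ j = u≋u′ j
... | inj₂ j = v≋v′ j

++-+ᵥ : ∀ {m n} (u u′ : Vector ℝ m) (v v′ : Vector ℝ n) →
        (u ++ v) +ᵥ (u′ ++ v′) ≋ (u +ᵥ u′) ++ (v +ᵥ v′)
++-+ᵥ {m} u u′ v v′ i with splitAt m i
... | inj₁ j = refl
... | inj₂ j = refl

-- The value of `splitAt m i` is the same for every summand, so a single case split reduces `++`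
-- throughout the sum.
++-lincomb : ∀ {k m n} (w : Vector ℝ k) (us : Vector (Vector ℝ m) k) (vs : Vector (Vector ℝ n) k) →
             lincomb w (λ i → us i ++ vs i) ≋ lincomb w us ++ lincomb w vs
++-lincomb {m = m} w us vs i with splitAt m i
... | inj₁ j = refl
... | inj₂ j = refl

*ᵥ-cong : ∀ {m n} (A : Matrix m n) {u v : Vector ℝ n} → u ≋ v → A *ᵥ u ≋ A *ᵥ v
*ᵥ-cong A u≋v i = sum-cong-≋ λ j → *-congˡ {x = A i j} (u≋v j)

*ᵥ-+ᵥ : ∀ {m n} (A : Matrix m n) (u v : Vector ℝ n) → A *ᵥ (u +ᵥ v) ≋ A *ᵥ u +ᵥ A *ᵥ v
*ᵥ-+ᵥ A u v i = trans
  (sum-cong-≋ λ j → distribˡ (A i j) (u j) (v j))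
  (∑-distrib-+ (zipWith _*_ (A i) u) (zipWith _*_ (A i) v))

*ᵥ-lincomb : ∀ {k m n} (A : Matrix m n) (w : Vector ℝ k) (vs : Vector (Vector ℝ n) k) →
             A *ᵥ lincomb w vs ≋ lincomb w (λ l → A *ᵥ vs l)
*ᵥ-lincomb A w vs i = begin
  sum (λ j → A i j * sum (λ l → w l * vs l j))   ≈⟨ sum-cong-≋ (λ j → *-distribˡ-sum (A i j) (λ l → w l * vs l j)) ⟩
  sum (λ j → sum (λ l → A i j * (w l * vs l j))) ≈⟨ ∑-comm (λ j l → A i j * (w l * vs l j)) ⟩
  sum (λ l → sum (λ j → A i j * (w l * vs l j))) ≈⟨ sum-cong-≋ (λ l → sum-cong-≋ λ j →
    solve 3 (λ a w v → a :* (w :* v) := w :* (a :* v)) refl (A i j) (w l) (vs l j)) ⟩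
  sum (λ l → sum (λ j → w l * (A i j * vs l j))) ≈⟨ sum-cong-≋ (λ l → *-distribˡ-sum (w l) (λ j → A i j * vs l j)) ⟨
  sum (λ l → w l * sum (λ j → A i j * vs l j))   ∎
  where open ≈-Reasoning setoid

-- By linearity each row becomes a sum of nonnegative multiples of nonpositive numbers: the
-- solutions of a homogeneous system of inequalities form a convex cone.
*ᵥ-lincomb-nonpos : ∀ {k m n} (A : Matrix m n) (w : Vector ℝ k) (vs : Vector (Vector ℝ n) k) →
                    0ᵥ ≤ᵥ w → (∀ l → A *ᵥ vs l ≤ᵥ 0ᵥ) → A *ᵥ lincomb w vs ≤ᵥ 0ᵥ
*ᵥ-lincomb-nonpos A w vs 0≤w rays i = ≤-respˡ-≈ (sym (*ᵥ-lincomb A w vs i))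
  (sum-nonpos (λ l → w l * (A *ᵥ vs l) i)
    λ l → ≤-respʳ-≈ (zeroʳ (w l)) (*-monoˡ-≤-nonNeg (0≤w l) (rays l i)))

-- Evolution of the weights.

nextWeights : ∀ {k} → Vector ℝ k → Vector ℝ (k ∸ 1) → Vector ℝ k → Vector ℝ k
-- The last index has no successor and hence no `μ` term. Recursion on tails makes it the base case
-- and keeps `μ` aligned with `lam`.
nextWeights {suc zero}    lam μ w zero    = lam zero * w zero
nextWeights {suc (suc k)} lam μ w zero    = lam zero * w zero + μ zero * w (suc zero)
nextWeights {suc (suc k)} lam μ w (suc i) = nextWeights (tail lam) (tail μ) (tail w) i

nextWeights-nonneg : ∀ {k} (lam : Vector ℝ k) (μ : Vector ℝ (k ∸ 1)) (w : Vector ℝ k) →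
                     0ᵥ ≤ᵥ lam → 0ᵥ ≤ᵥ μ → 0ᵥ ≤ᵥ w → 0ᵥ ≤ᵥ nextWeights lam μ w
nextWeights-nonneg {suc zero}    lam μ w 0≤lam 0≤μ 0≤w zero = *-nonneg (0≤lam zero) (0≤w zero)
nextWeights-nonneg {suc (suc k)} lam μ w 0≤lam 0≤μ 0≤w zero =
  +-nonneg (*-nonneg (0≤lam zero) (0≤w zero)) (*-nonneg (0≤μ zero) (0≤w (suc zero)))
nextWeights-nonneg {suc (suc k)} lam μ w 0≤lam 0≤μ 0≤w (suc i) =
  nextWeights-nonneg (tail lam) (tail μ) (tail w)
    (λ i → 0≤lam (suc i)) (λ i → 0≤μ (suc i)) (λ i → 0≤w (suc i)) i

-- The clauses mirror those of `Ray`, so the ray conditions apply to these vectors by computation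
-- alone.
rayImage : ∀ {k n} → Vector ℝ k → Vector ℝ (k ∸ 1) → Vector (Vector ℝ n) k → Vector (Vector ℝ n) k
rayImage lam μ y zero    = lam zero *ₛ y zero
rayImage lam μ y (suc i) = lam (suc i) *ₛ y (suc i) +ᵥ μ i *ₛ y (inject₁ i)

Ray⇒nonpos : ∀ {k m n} (A : Matrix m (n ℕ.+ n)) (y : Vector (Vector ℝ n) k) lam μ →
             Ray A k y lam μ → ∀ i → A *ᵥ (y i ++ rayImage lam μ y i) ≤ᵥ 0ᵥ
Ray⇒nonpos {suc k} A y lam μ (r , rs) zero    = r
Ray⇒nonpos {suc k} A y lam μ (r , rs) (suc i) = rs i

-- The two operations are given by transposed bidiagonal matrices: the cross term μᵢ wᵢ₊₁ yᵢ sits in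
-- summand i on the left and in summand i+1 on the right. The induction moves one such term at a
-- time.
lincomb-nextWeights : ∀ {k n} (lam : Vector ℝ k) μ w (y : Vector (Vector ℝ n) k) →
                      lincomb (nextWeights lam μ w) y ≋ lincomb w (rayImage lam μ y)
lincomb-nextWeights {zero}        lam μ w y j = refl
lincomb-nextWeights {suc zero}    lam μ w y j = +-congʳ
  (solve 3 (λ l w y → l :* w :* y := w :* (l :* y)) refl (lam zero) (w zero) (y zero j))
lincomb-nextWeights {suc (suc k)} lam μ w y j = trans
  (+-congˡ (lincomb-nextWeights (tail lam) (tail μ) (tail w) (tail y) j))
  -- The `rayImage` of the tails starts without a `μ` term; the head of the left sum supplies it.
  -- Here `s` is the rest of the sum from index 2 on, common to both sides.
  (solve 8 (λ l₀ w₀ m w₁ y₀ l₁ y₁ s →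
       (l₀ :* w₀ :+ m :* w₁) :* y₀ :+ (w₁ :* (l₁ :* y₁) :+ s)
    := w₀ :* (l₀ :* y₀) :+ (w₁ :* (l₁ :* y₁ :+ m :* y₀) :+ s)) refl
    (lam zero) (w zero) (μ zero) (w (suc zero)) (y zero j) (lam (suc zero)) (y (suc zero) j) _)

proposition6 : ∀ {n : ℕ} (L : LassoProgram n) →
    (∃[ k ] GeometricNonterminationArgument L k) → Nonterminating L
proposition6 {n} L (k , gna) = execution , initiation , λ { (suc t) _ → loop t }
  where
  open LassoProgram L
  open LinearRelation LOOP
  open GeometricNonterminationArgument gna

  weights : ℕ → Vector ℝ k
  weights zero    = λ _ → 1ℝ
  weights (suc t) = nextWeights lam μ (weights t)

  weights-nonneg : ∀ t → 0ᵥ ≤ᵥ weights t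
  weights-nonneg zero    = λ _ → 0≤1
  weights-nonneg (suc t) =
    nextWeights-nonneg lam μ (weights t) lam-nonneg μ-nonneg (weights-nonneg t)

  execution : ℕ → Vector ℝ n
  execution zero          = x₀
  execution (suc zero)    = x₁
  -- The move from `x₀` to `x₁` belongs to `STEM`, so the weights lag two behind the new state:
  -- `weights zero` drives the first `LOOP` transition.
  execution (suc (suc t)) = execution (suc t) +ᵥ lincomb (weights t) y

  z : Vector (Vector ℝ n) k
  z = rayImage lam μ y

  loop : ∀ t → ⟦ LOOP ⟧ (execution (suc t)) (execution (suc (suc t)))
  -- All weights are still 1, so the first increment is `sumᵥ y` up to `*-identityˡ`, as in `point`.
  loop zero i = ≤-respˡ-≈
    (*ᵥ-cong A {u = x₁ ++ (x₁ +ᵥ sumᵥ y)} (++-cong {u = x₁} (λ _ → refl) λ j →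
      +-congˡ (sum-cong-≋ λ l → sym (*-identityˡ (y l j)))) i)
    (point i)
  -- The previous transition contributes at most `b i` and the combination of rays at most 0.
  loop (suc t) i = ≤-respʳ-≈ (+-identityʳ (b i)) (≤-respˡ-≈ (sym split)
    (+-mono-≤ (loop t i) (*ᵥ-lincomb-nonpos A w (λ l → y l ++ z l) (weights-nonneg t)
      (Ray⇒nonpos A y lam μ ray) i)))
    where
    w = weights t
    w′ = weights (suc t)
    x = execution (suc t)
    x′ = execution (suc (suc t))
    step : (x ++ x′) +ᵥ lincomb w (λ l → y l ++ z l) ≋ x′ ++ (x′ +ᵥ lincomb w′ y)
    step j = begin
      (x ++ x′) j + lincomb w (λ l → y l ++ z l) j ≈⟨ +-congˡ (++-lincomb w y z j) ⟩
      (x ++ x′) j + (lincomb w y ++ lincomb w z) j ≈⟨ ++-+ᵥ x (lincomb w y) x′ (lincomb w z) j ⟩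
      -- The first half is `x′` by definition of `execution`; the second trades the images `z` under
      -- the old weights for `y` under the new ones.
      ((x +ᵥ lincomb w y) ++ (x′ +ᵥ lincomb w z)) j ≈⟨ ++-cong {u = x′} (λ _ → refl)
        (λ l → +-congˡ (sym (lincomb-nextWeights lam μ w y l))) j ⟩
      (x′ ++ (x′ +ᵥ lincomb w′ y)) j ∎
      where open ≈-Reasoning setoid
    split : (A *ᵥ (x′ ++ (x′ +ᵥ lincomb w′ y))) i ≈
            (A *ᵥ (x ++ x′)) i + (A *ᵥ lincomb w (λ l → y l ++ z l)) i
    split = trans (sym (*ᵥ-cong A step i)) (*ᵥ-+ᵥ A (x ++ x′) (lincomb w (λ l → y l ++ z l)) i)
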